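{- Let $(G,\precsim)$ be a C-quasi-ordered group. The C-quasi-order $\precsim$ is order-type if and only if there exists a subset $G^+$ of $G$ such that the following holds: (i) $G=G^+\sqcup G^-\sqcup\{1\}$ (disjoint unions), where $G^-:=\{g^{ -1}\mid g\in G^+\}$; (ii) $1\precnsim G^-\precnsim G^+$; (iii) $\precsim$ is trivial on $G^-$ (i.e. $a\sim b$ for all $a,b\in G^-$) and coincides with an order $\leq$ on $G^+$.
   Context: A quasi-order is a reflexive, transitive and total binary relation $\precsim$; $a\sim b$ means $a\precsim b\precsim a$, and $a\precnsim b$ means $a\precsim b$ and $a\nsim b$. For subsets, $S\precnsim T$ means $s\precnsim t$ for all $s\in S$, $t\in T$ (a single element stands for its singleton). A C-relation on a set is a ternary relation $C$ such that for all $x,y,z,w$: $C(x,y,z)\Rightarrow C(x,z,y)$; $C(x,y,z)\Rightarrow\neg C(y,x,z)$; $C(x,y,z)\Rightarrow C(w,y,z)\vee C(x,w,z)$; $x\neq y\Rightarrow C(x,y,y)$. On a group it is compatible if $C(x,y,z)$ implies $C(vxu,vyu,vzu)$ for all $x,y,z,u,v$. A C-quasi-order on a group $G$ is a quasi-order of the form $x\precsim y\Leftrightarrow\neg C(x,y,1)$ with $C$ a compatible C-relation (which is then unique: $C(x,y,z)\Leftrightarrow yz^{ -1}\precnsim xz^{ -1}$); a C-quasi-ordered group is a group with a C-quasi-order. The C-quasi-order is order-type if its C-relation is of the form $C(x,y,z)\Leftrightarrow(y<x\wedge z<x)\vee(y=z\neq x)$ for some total order $\leq$ making $G$ an ordered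 group, i.e. $x\leq y$ implies $xz\leq yz$ and $zx\leq zy$. -}

module Defs where

open import Level using (Level; _⊔_; suc)
open import Algebra.Bundles using (Group)
open import Data.Product using (Σ; ∃; ∃-syntax; _×_; proj₁)
open import Data.Sum using (_⊎_)
open import Function.Base using (_on_)
open import Function.Bundles using (_⇔_)
open import Relation.Binary.Core using (Rel)
open import Relation.Binary.Structures using (IsTotalPreorder; IsTotalOrder)
import Relation.Binary.Construct.NonStrictToStrict as ToStrict
open import Relation.Nullary using (¬_)
open import Relation.Unary using (Pred; _∈_; _∪_; _⊥_; Universal)

module _ {a ℓ r : Level} {A : Set a} (_≈_ : Rel A ℓ) (C : A → A → A → Set r) where

  -- Sets are setoids here, so a relation has to respect the equality _≈_.
  record IsCRelation : Set (a ⊔ ℓ ⊔ r) where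
    field
      resp-≈ : ∀ {x x′ y y′ z z′} → x ≈ x′ → y ≈ y′ → z ≈ z′ → C x y z → C x′ y′ z′
      swap   : ∀ {x y z} → C x y z → C x z y
      asym   : ∀ {x y z} → C x y z → ¬ C y x z
      cotrans : ∀ {x y z} w → C x y z → C w y z ⊎ C x w z
      distinct : ∀ {x y} → ¬ (x ≈ y) → C x y y

module _ {c ℓ r : Level} (G : Group c ℓ) where
  open Group G

  Compatible : (Carrier → Carrier → Carrier → Set r) → Set (c ⊔ r)
  Compatible C = ∀ {x y z} u v → C x y z → C (v ∙ x ∙ u) (v ∙ y ∙ u) (v ∙ z ∙ u)

  record IsGroupOrder (_≤_ : Rel Carrier r) : Set (c ⊔ ℓ ⊔ r) where
    field
      isTotalOrder : IsTotalOrder _≈_ _≤_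
      ∙-monoˡ      : ∀ {x y} z → x ≤ y → (x ∙ z) ≤ (y ∙ z)
      ∙-monoʳ      : ∀ {x y} z → x ≤ y → (z ∙ x) ≤ (z ∙ y)

-- C is determined by _≾_ up to logical equivalence, so having it as a field
-- adds no structure.
record CQuasiOrderedGroup (c ℓ r : Level) : Set (suc (c ⊔ ℓ ⊔ r)) where
  infix 4 _≾_ _∼_ _≺_ _≺ˢ_
  field
    group : Group c ℓ
  open Group group public
  field
    _≾_          : Rel Carrier r
    isQuasiOrder : IsTotalPreorder _≈_ _≾_
    C            : Carrier → Carrier → Carrier → Set r
    isCRelation  : IsCRelation _≈_ C
    compatible   : Compatible group C
    ≾⇔¬C         : ∀ x y → (x ≾ y) ⇔ (¬ C x y ε)

  _∼_ : Rel Carrier r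
  a ∼ b = a ≾ b × b ≾ a

  _≺_ : Rel Carrier r
  _≺_ = ToStrict._<_ _∼_ _≾_

  _≺ˢ_ : ∀ {p q} → Pred Carrier p → Pred Carrier q → Set (c ⊔ r ⊔ p ⊔ q)
  S ≺ˢ T = ∀ {s t} → s ∈ S → t ∈ T → s ≺ t

  ｛ε｝ : Pred Carrier ℓ
  ｛ε｝ x = x ≈ ε

  Inverses : ∀ {p} → Pred Carrier p → Pred Carrier (c ⊔ ℓ ⊔ p)
  Inverses P x = ∃[ g ] g ∈ P × x ≈ g ⁻¹

  IsPartition₃ : ∀ {p q s} → Pred Carrier p → Pred Carrier q → Pred Carrier s →
                 Set (c ⊔ p ⊔ q ⊔ s)
  IsPartition₃ P Q S = Universal (P ∪ Q ∪ S) × P ⊥ Q × P ⊥ S × Q ⊥ S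

  TrivialOn : ∀ {p} → Pred Carrier p → Set (c ⊔ r ⊔ p)
  TrivialOn P = ∀ {a b} → a ∈ P → b ∈ P → a ∼ b

  -- The order lives on the subset P only; elements of ∃ P are compared by
  -- their underlying group elements, irrespective of the membership proofs.
  CoincidesWithOrderOn : ∀ {p} → Pred Carrier p → Set (c ⊔ suc (ℓ ⊔ r) ⊔ p)
  CoincidesWithOrderOn P =
    Σ (Rel (∃ P) (ℓ ⊔ r)) λ _≤_ →
      IsTotalOrder (_≈_ on proj₁) _≤_
      × (∀ a b → (proj₁ a ≾ proj₁ b) ⇔ (a ≤ b))

  -- Level ℓ ⊔ r stands for "any relation": under excluded middle every
  -- proposition is equivalent to one in any universe.
  record IsOrderType : Set (c ⊔ suc (ℓ ⊔ r)) where
    field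
      _≤_          : Rel Carrier (ℓ ⊔ r)
      isGroupOrder : IsGroupOrder group _≤_

    open ToStrict _≈_ _≤_ public using (_<_)

    field
      C⇔ : ∀ x y z → C x y z ⇔ ((y < x × z < x) ⊎ (y ≈ z × ¬ (z ≈ x)))

{-# OPTIONS --safe #-}

-- From an order, G⁺ is the set of elements above ε. Conversely, given G⁺, put
-- x < y iff y x⁻¹ ∈ G⁺. Each implication of
--   C x y z ⇔ (y < x × z < x) ⊎ (y ≈ z × z ≉ x)
-- is read off the position of the elements relative to G⁻ and G⁺ after
-- translating one of them to ε. In particular x < y iff C y w x for some w ≉ x,
-- so that transitivity and invariance of < on both sides are inherited from C.
module Submission where

open import Defs
open import Level using (Level; _⊔_; Lift; lift; lower)
open import Axiom.ExcludedMiddle using (ExcludedMiddle)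
open import Data.Product using (Σ-syntax; _×_; _,_; proj₁; proj₂)
open import Data.Sum using (_⊎_; inj₁; inj₂)
open import Function.Base using (_∘_; _on_; case_of_)
open import Function.Bundles using (_⇔_; mk⇔; module Equivalence)
open import Relation.Binary.Construct.On using () renaming (isTotalOrder to on-isTotalOrder)
import Relation.Binary.Construct.NonStrictToStrict as ToStrict
import Relation.Binary.Construct.StrictToNonStrict as ToNonStrict
open import Relation.Binary.Core using (Rel)
open import Relation.Binary.Definitions
  using (_Respects_; _Respects₂_; Asymmetric; Irreflexive; Transitive; Trichotomous
        ; tri<; tri≈; tri>)
open import Relation.Binary.Structures
  using (IsTotalOrder; IsTotalPreorder; IsStrictTotalOrder)
open import Relation.Nullary using (¬_; yes; no; contradiction)
open import Relation.Nullary.Decidable using (map′; decidable-stable)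
open import Relation.Unary using (Pred; _∈_)
import Algebra.Properties.Group as GroupProperties

open Equivalence using (to; from)

em-lower : ∀ {a b} → ExcludedMiddle (a ⊔ b) → ExcludedMiddle a
em-lower {b = b} em {P} = map′ lower lift (em {Lift b P})

module _ {c ℓ r : Level} (G : CQuasiOrderedGroup c ℓ r) where
  open CQuasiOrderedGroup G

  -- `G⁺` has to respect `_≈_`, because in a setoid only such predicates are subsets.
  HasPositivePart : Set _
  HasPositivePart = Σ[ G⁺ ∈ Pred Carrier (ℓ ⊔ r) ] let G⁻ = Inverses G⁺ in
        G⁺ Respects _≈_
        × IsPartition₃ G⁺ G⁻ ｛ε｝
        × (｛ε｝ ≺ˢ G⁻ × G⁻ ≺ˢ G⁺)
        × (TrivialOn G⁻ × CoincidesWithOrderOn G⁺)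

module _ {c ℓ r : Level} (em : ExcludedMiddle (c ⊔ ℓ ⊔ r)) (G : CQuasiOrderedGroup c ℓ r) where
  open CQuasiOrderedGroup G
  open GroupProperties group
  open IsCRelation isCRelation
  open IsTotalPreorder isQuasiOrder using () renaming (total to ≾-total)

  -- Excluded middle at smaller levels; the C-relation with last argument `ε`.

  em-ℓ : ExcludedMiddle ℓ
  em-ℓ = em-lower {b = c ⊔ r} em

  em-r : ExcludedMiddle r
  em-r = em-lower {b = c ⊔ ℓ} em

  em-ℓ⊔r : ExcludedMiddle (ℓ ⊔ r)
  em-ℓ⊔r = em-lower {b = c} em

  -- If `C x y ε` failed, then `x ≾ y` would hold and make `x ∼ y`.
  ≺⇒C : ∀ {x y} → y ≺ x → C x y ε
  ≺⇒C {x} {y} (y≾x , y≁x) =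
    decidable-stable em-r λ ¬C → y≁x (y≾x , from (≾⇔¬C x y) ¬C)

  C⇒≺ : ∀ {x y} → C x y ε → y ≺ x
  C⇒≺ {x} {y} Cxyε = y≾x , λ (_ , x≾y) → to (≾⇔¬C x y) x≾y Cxyε
    where
    y≾x : y ≾ x
    y≾x with ≾-total x y
    ... | inj₁ x≾y = contradiction Cxyε (to (≾⇔¬C x y) x≾y)
    ... | inj₂ y≾x = y≾x

  -- Otherwise `C y y z` would hold, and exchanging its first two arguments would contradict `asym`.
  C⇒x≉y : ∀ {x y z} → C x y z → ¬ (x ≈ y)
  C⇒x≉y Cxyz x≈y = asym Cyyz Cyyz
    where Cyyz = resp-≈ x≈y refl refl Cxyz

  C-translateʳ : ∀ {x y z} u → C x y z → C (x ∙ u) (y ∙ u) (z ∙ u)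
  C-translateʳ u Cxyz = resp-≈ (lem _) (lem _) (lem _) (compatible u ε Cxyz)
    where
    lem : ∀ x → ε ∙ x ∙ u ≈ x ∙ u
    lem x = ∙-congʳ (identityˡ x)

  -- From a group order to its positive and negative elements.

  module _ (orderType : IsOrderType) where
    open IsOrderType orderType
    open IsGroupOrder isGroupOrder
    open IsTotalOrder isTotalOrder
      using (antisym; total; ≤-resp-≈; ≤-respˡ-≈; ≤-respʳ-≈) renaming (reflexive to ≤-reflexive)

    Positive : Pred Carrier (ℓ ⊔ r)
    Positive x = ε < x

    private
      <-asym : Asymmetric _<_
      <-asym = ToStrict.<-asym _≈_ _≤_ antisym

      <-respˡ : ∀ {x y z} → x ≈ y → x < z → y < z
      <-respˡ = ToStrict.<-respˡ-≈ _≈_ _≤_ trans ≤-respˡ-≈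

      <-respʳ : ∀ {x y z} → x ≈ y → z < x → z < y
      <-respʳ = ToStrict.<-respʳ-≈ _≈_ _≤_ sym trans ≤-respʳ-≈

      <-compare : Trichotomous _≈_ _<_
      <-compare = ToStrict.<-trichotomous _≈_ _≤_ sym (λ _ _ → em-ℓ) antisym total

      <-∙-monoˡ : ∀ {x y} z → x < y → x ∙ z < y ∙ z
      <-∙-monoˡ z (x≤y , x≉y) = ∙-monoˡ z x≤y , x≉y ∘ ∙-cancelʳ z _ _

      negative⇒<ε : ∀ {x} → x ∈ Inverses Positive → x < ε
      negative⇒<ε (g , ε<g , x≈g⁻¹) =
        <-respˡ (trans (identityˡ _) (sym x≈g⁻¹)) (<-respʳ (inverseʳ g) (<-∙-monoˡ (g ⁻¹) ε<g))

      <ε⇒negative : ∀ {x} → x < ε → x ∈ Inverses Positive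
      <ε⇒negative {x} x<ε =
        x ⁻¹ , <-respˡ (inverseʳ x) (<-respʳ (identityˡ _) (<-∙-monoˡ (x ⁻¹) x<ε))
        , sym (⁻¹-involutive x)

      positive-partition : IsPartition₃ Positive (Inverses Positive) ｛ε｝
      positive-partition =
        (λ x → case <-compare x ε of λ where
          (tri< x<ε _ _) → inj₂ (inj₁ (<ε⇒negative x<ε))
          (tri≈ _ x≈ε _) → inj₂ (inj₂ x≈ε)
          (tri> _ _ ε<x) → inj₁ ε<x)
        , (λ (ε<x , neg) → <-asym ε<x (negative⇒<ε neg))
        , (λ (ε<x , x≈ε) → proj₂ ε<x (sym x≈ε))
        , (λ (neg , x≈ε) → proj₂ (negative⇒<ε neg) x≈ε)

      ε≺negative : ｛ε｝ ≺ˢ Inverses Positive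
      ε≺negative {s} {t} s≈ε t∈G⁻ =
        -- Since `s ≈ ε`, this is the alternative in which the last two arguments of `C` agree.
        C⇒≺ (from (C⇔ t s ε) (inj₂ (s≈ε , proj₂ (negative⇒<ε t∈G⁻) ∘ sym)))

      negative≺positive : Inverses Positive ≺ˢ Positive
      negative≺positive {s} {t} s∈G⁻ ε<t =
        C⇒≺ (from (C⇔ t s ε) (inj₁ (<-trans (negative⇒<ε s∈G⁻) ε<t , ε<t)))
        where
        <-trans : Transitive _<_
        <-trans = ToStrict.<-trans _≈_ _≤_ (IsTotalOrder.isPartialOrder isTotalOrder)

      -- Both alternatives for `C a b ε` fail: one needs `ε < a`, the other `b ≈ ε`.
      negative-≾ : ∀ {a b} → a ∈ Inverses Positive → b ∈ Inverses Positive → a ≾ b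
      negative-≾ {a} {b} a∈G⁻ b∈G⁻ = from (≾⇔¬C a b) λ Cabε →
        case to (C⇔ a b ε) Cabε of λ where
          (inj₁ (_ , ε<a)) → <-asym ε<a (negative⇒<ε a∈G⁻)
          (inj₂ (b≈ε , _)) → proj₂ (negative⇒<ε b∈G⁻) b≈ε

      -- For positive `a` and `b`, the formula for `C a b ε` reduces to `b < a`: the condition
      -- `ε < a` holds and `b ≈ ε` is excluded.
      ≾⇔≤ : ∀ {a b} → ε < a → ε < b → (a ≾ b) ⇔ (a ≤ b)
      ≾⇔≤ {a} {b} ε<a ε<b = mk⇔
        (λ a≾b → decidable-stable em-ℓ⊔r λ a≰b →
          to (≾⇔¬C a b) a≾b (from (C⇔ a b ε)
            (inj₁ (ToStrict.≰⇒> _≈_ _≤_ sym ≤-reflexive total a≰b , ε<a))))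
        (λ a≤b → from (≾⇔¬C a b) λ Cabε → case to (C⇔ a b ε) Cabε of λ where
          (inj₁ (b<a , _)) → ToStrict.<⇒≱ _≈_ _≤_ antisym b<a a≤b
          (inj₂ (b≈ε , _)) → proj₂ ε<b (sym b≈ε))

    orderType⇒hasPositivePart : HasPositivePart G
    orderType⇒hasPositivePart =
      Positive , <-respʳ , positive-partition , (ε≺negative , negative≺positive)
      , (λ a∈G⁻ b∈G⁻ → negative-≾ a∈G⁻ b∈G⁻ , negative-≾ b∈G⁻ a∈G⁻)
      , (_≤_ on proj₁) , on-isTotalOrder proj₁ isTotalOrder
      , λ (_ , ε<a) (_ , ε<b) → ≾⇔≤ ε<a ε<b

  -- From the positive part to a group order.

  module _ {G⁺ : Pred Carrier (ℓ ⊔ r)} (G⁺-resp : G⁺ Respects _≈_)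
    (partition : IsPartition₃ G⁺ (Inverses G⁺) ｛ε｝)
    (G⁻≺G⁺ : Inverses G⁺ ≺ˢ G⁺) (G⁻-trivial : TrivialOn (Inverses G⁺)) where

    private
      G⁻ : Pred Carrier (c ⊔ ℓ ⊔ r)
      G⁻ = Inverses G⁺

      cover = proj₁ partition
      G⁺⊥G⁻ = proj₁ (proj₂ partition)
      G⁺⊥ε = proj₁ (proj₂ (proj₂ partition))
      G⁻⊥ε = proj₂ (proj₂ (proj₂ partition))

      infix 4 _⊏_
      _⊏_ : Rel Carrier (ℓ ⊔ r)
      x ⊏ y = y // x ∈ G⁺

      ⊏⇒flip∈G⁻ : ∀ {x y} → x ⊏ y → x // y ∈ G⁻
      ⊏⇒flip∈G⁻ {x} {y} x⊏y = y // x , x⊏y , sym (⁻¹-anti-homo-// y x)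

      flip∈G⁻⇒⊏ : ∀ {x y} → x // y ∈ G⁻ → x ⊏ y
      flip∈G⁻⇒⊏ {x} {y} (g , g∈G⁺ , eq) =
        G⁺-resp (trans (sym (⁻¹-involutive g)) (trans (⁻¹-cong (sym eq)) (⁻¹-anti-homo-// x y))) g∈G⁺

      ⊏-resp : _⊏_ Respects₂ _≈_
      ⊏-resp = (λ y≈y′ → G⁺-resp (//-cong₂ y≈y′ refl)) , (λ x≈x′ → G⁺-resp (//-cong₂ refl x≈x′))

      ⊏-irrefl : Irreflexive _≈_ _⊏_
      ⊏-irrefl x≈y x⊏y = G⁺⊥ε (x⊏y , x≈y⇒x∙y⁻¹≈ε (sym x≈y))

      ⊏-asym : Asymmetric _⊏_
      ⊏-asym x⊏y y⊏x = G⁺⊥G⁻ (x⊏y , ⊏⇒flip∈G⁻ y⊏x)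

      -- The three cases are the three parts of the group in which `y // x` can lie.
      ⊏-compare : Trichotomous _≈_ _⊏_
      ⊏-compare x y with cover (y // x)
      ... | inj₁ x⊏y = tri< x⊏y (λ eq → ⊏-irrefl eq x⊏y) (⊏-asym x⊏y)
      ... | inj₂ (inj₁ neg) = tri> (⊏-asym y⊏x) (λ eq → ⊏-irrefl (sym eq) y⊏x) y⊏x
        where y⊏x = flip∈G⁻⇒⊏ neg
      ... | inj₂ (inj₂ eq) = tri≈ (⊏-irrefl x≈y) x≈y (⊏-irrefl (sym x≈y))
        where x≈y = sym (x∙y⁻¹≈ε⇒x≈y y x eq)

      C-positive-negative : ∀ {s t} x → s ∈ G⁻ → t ∈ G⁺ → C (t ∙ x) (s ∙ x) x
      C-positive-negative x s∈G⁻ t∈G⁺ =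
        resp-≈ refl refl (identityˡ x) (C-translateʳ x (≺⇒C (G⁻≺G⁺ s∈G⁻ t∈G⁺)))

      -- Right translation taking the middle element `y` to `ε` makes `z` negative and `x` positive.
      ⊏-⊏⇒C : ∀ {x y z} → z ⊏ y → y ⊏ x → C x z y
      ⊏-⊏⇒C {x} {y} {z} z⊏y y⊏x =
        resp-≈ (//-rightDividesˡ y x) (//-rightDividesˡ y z) refl
          (C-positive-negative y (⊏⇒flip∈G⁻ z⊏y) y⊏x)

      -- Outside the unit, `G⁻` is the lowest class: it lies below `G⁺` and is a single class of
      -- `_∼_`.
      negative-≾-nonunit : ∀ {a b} → a ∈ G⁻ → ¬ (b ≈ ε) → a ≾ b
      negative-≾-nonunit {b = b} a∈G⁻ b≉ε with cover b
      ... | inj₁ b∈G⁺ = proj₁ (G⁻≺G⁺ a∈G⁻ b∈G⁺)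
      ... | inj₂ (inj₁ b∈G⁻) = proj₁ (G⁻-trivial a∈G⁻ b∈G⁻)
      ... | inj₂ (inj₂ b≈ε) = contradiction b≈ε b≉ε

      -- Translate `z` to `ε`. As `y // z` is not the unit, a negative `x // z` would be `≾` it,
      -- against `C`; and `x ≈ z` is impossible under `C x y z`. So `x // z` is positive.
      C⇒⊏ : ∀ {x y z} → C x y z → ¬ (y ≈ z) → z ⊏ x
      C⇒⊏ {x} {y} {z} Cxyz y≉z with cover (x // z)
      ... | inj₁ z⊏x = z⊏x
      ... | inj₂ (inj₁ x//z∈G⁻) =
        contradiction
          (resp-≈ refl refl (inverseʳ z) (C-translateʳ (z ⁻¹) Cxyz))
          (to (≾⇔¬C _ _) (negative-≾-nonunit x//z∈G⁻ (y≉z ∘ x∙y⁻¹≈ε⇒x≈y y z)))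
      ... | inj₂ (inj₂ eq) = contradiction (x∙y⁻¹≈ε⇒x≈y x z eq) (C⇒x≉y (swap Cxyz))

      ⊏-trans : Transitive _⊏_
      ⊏-trans x⊏y y⊏z = C⇒⊏ (swap (⊏-⊏⇒C x⊏y y⊏z)) λ y≈x → ⊏-irrefl (sym y≈x) x⊏y

      -- The relation `C y w x` with `w = (y // x) ⁻¹ ∙ x` is carried along by compatibility, and
      -- `C⇒⊏` reads the order off the translate. This gives left invariance too, although `_⊏_` is
      -- defined by right quotients.
      ⊏-∙-mono : ∀ {x y} u v → x ⊏ y → v ∙ x ∙ u ⊏ v ∙ y ∙ u
      ⊏-∙-mono {x} {y} u v x⊏y =
        proj₁ ⊏-resp (∙-congʳ (∙-congˡ (//-rightDividesˡ x y)))
          -- The translates of `w` and `x` differ: by cancellation, equality would make the negative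
          -- element `(y // x) ⁻¹` the unit.
          (C⇒⊏ (compatible u v (C-positive-negative x g⁻¹∈G⁻ x⊏y)) λ eq →
            G⁻⊥ε (g⁻¹∈G⁻ , identityˡ-unique _ x (∙-cancelˡ v _ _ (∙-cancelʳ u _ _ eq))))
        where
        g⁻¹∈G⁻ : (y // x) ⁻¹ ∈ G⁻
        g⁻¹∈G⁻ = y // x , x⊏y , refl

      ⊏-isStrictTotalOrder : IsStrictTotalOrder _≈_ _⊏_
      ⊏-isStrictTotalOrder = record
        { isStrictPartialOrder = record
          { isEquivalence = isEquivalence
          ; irrefl = ⊏-irrefl
          ; trans = ⊏-trans
          ; <-resp-≈ = ⊏-resp
          }
        ; compare = ⊏-compare
        }

      open ToNonStrict _≈_ _⊏_ using () renaming (_≤_ to _⊑_; isTotalOrder to ⊑-isTotalOrder)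
      open ToStrict _≈_ _⊑_ using (_<_)

      -- Together with `⊏⇒<`, this identifies the strict part of `_⊑_` with `_⊏_`; the order-type
      -- formula is phrased with the strict part of a non-strict order.
      <⇒⊏ : ∀ {x y} → x < y → x ⊏ y
      <⇒⊏ (inj₁ x⊏y , _) = x⊏y
      <⇒⊏ (inj₂ x≈y , x≉y) = contradiction x≈y x≉y

      ⊏⇒< : ∀ {x y} → x ⊏ y → x < y
      ⊏⇒< x⊏y = inj₁ x⊏y , λ x≈y → ⊏-irrefl x≈y x⊏y

      ⊑-isGroupOrder : IsGroupOrder group _⊑_
      ⊑-isGroupOrder = record
        { isTotalOrder = ⊑-isTotalOrder ⊏-isStrictTotalOrder
        ; ∙-monoˡ = λ where
            z (inj₁ x⊏y) → inj₁ (⊏-resp₂ (∙-congʳ (identityˡ _)) (∙-congʳ (identityˡ _)) (⊏-∙-mono z ε x⊏y))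
            z (inj₂ x≈y) → inj₂ (∙-congʳ x≈y)
        ; ∙-monoʳ = λ where
            z (inj₁ x⊏y) → inj₁ (⊏-resp₂ (identityʳ _) (identityʳ _) (⊏-∙-mono ε z x⊏y))
            z (inj₂ x≈y) → inj₂ (∙-congˡ x≈y)
        }
        where
        ⊏-resp₂ : ∀ {x x′ y y′} → x ≈ x′ → y ≈ y′ → x ⊏ y → x′ ⊏ y′
        ⊏-resp₂ x≈x′ y≈y′ = proj₁ ⊏-resp y≈y′ ∘ proj₂ ⊏-resp x≈x′

      C⇔⊏ : ∀ x y z → C x y z ⇔ ((y < x × z < x) ⊎ (y ≈ z × ¬ (z ≈ x)))
      C⇔⊏ x y z = mk⇔ C⇒ ⇒C
        where
        C⇒ : C x y z → (y < x × z < x) ⊎ (y ≈ z × ¬ (z ≈ x))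
        C⇒ Cxyz with em-ℓ {y ≈ z}
        ... | yes y≈z = inj₂ (y≈z , C⇒x≉y (swap Cxyz) ∘ sym)
        -- `C` is symmetric in its last two arguments, so `C⇒⊏` places both of them below `x`.
        ... | no y≉z = inj₁ (⊏⇒< (C⇒⊏ (swap Cxyz) (y≉z ∘ sym)) , ⊏⇒< (C⇒⊏ Cxyz y≉z))

        equal⇒C : y ≈ z → ¬ (z ≈ x) → C x y z
        equal⇒C y≈z z≉x = resp-≈ refl (sym y≈z) refl (distinct (z≉x ∘ sym))

        ⇒C : (y < x × z < x) ⊎ (y ≈ z × ¬ (z ≈ x)) → C x y z
        ⇒C (inj₂ (y≈z , z≉x)) = equal⇒C y≈z z≉x
        -- If `y` and `z` differ, the larger one lies between the smaller one and `x`, which is the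
        -- situation of `⊏-⊏⇒C`.
        ⇒C (inj₁ (y<x , z<x)) with ⊏-compare y z
        ... | tri< y⊏z _ _ = ⊏-⊏⇒C y⊏z (<⇒⊏ z<x)
        ... | tri≈ _ y≈z _ = equal⇒C y≈z (proj₂ z<x)
        ... | tri> _ _ z⊏y = swap (⊏-⊏⇒C z⊏y (<⇒⊏ y<x))

    positivePart⇒orderType : IsOrderType
    positivePart⇒orderType = record
      { _≤_ = _⊑_
      ; isGroupOrder = ⊑-isGroupOrder
      ; C⇔ = C⇔⊏
      }

proposition2p8 : {c ℓ r : Level} → ExcludedMiddle (c ⊔ ℓ ⊔ r) →
    (G : CQuasiOrderedGroup c ℓ r) → let open CQuasiOrderedGroup G in
    IsOrderType ⇔
    (Σ[ G⁺ ∈ Pred Carrier (ℓ ⊔ r) ] let G⁻ = Inverses G⁺ in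
    G⁺ Respects _≈_
    × IsPartition₃ G⁺ G⁻ ｛ε｝
    × (｛ε｝ ≺ˢ G⁻ × G⁻ ≺ˢ G⁺)
    × (TrivialOn G⁻ × CoincidesWithOrderOn G⁺))
proposition2p8 em G = mk⇔
  (orderType⇒hasPositivePart em G)
  λ (_ , G⁺-resp , partition , (_ , G⁻≺G⁺) , (G⁻-trivial , _)) →
    positivePart⇒orderType em G G⁺-resp partition G⁻≺G⁺ G⁻-trivial
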